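{- For every integer $g\geq 3$, the set of base-$g$ Niven numbers is an asymptotic basis of order $3$: there exists $N_0=N_0(g)$ such that every integer $M\geq N_0$ can be written as $M=n_1+n_2+n_3$ with $n_1,n_2,n_3$ base-$g$ Niven numbers.
   Context: For an integer $g\geq 2$, $s_g(n)$ denotes the sum of the base-$g$ digits of a natural number $n$. A base-$g$ Niven number is a natural number $n\geq 1$ that is divisible by $s_g(n)$. -}

module Defs where

open import Data.Nat using (ℕ; zero; suc; _+_; _≤_; _<_)
open import Data.Nat.DivMod using (_/_; _%_)
open import Data.Nat.Divisibility using (_∣_)
open import Data.Product using (_×_)

-- Sum of base-(2+b) digits, with an explicit fuel parameter.
-- The fuel k suffices as soon as n < g^k; since n < g^n always,
-- fuel n is always enough.
digitSumAux : ℕ → ℕ → ℕ → ℕ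
digitSumAux g zero    n = 0
digitSumAux g (suc k) zero = 0
digitSumAux g (suc k) (suc m) with g
... | zero = 0
... | suc h = ((suc m) % suc h) + digitSumAux (suc h) k ((suc m) / suc h)

-- s_g(n): sum of the base-g digits of n (meaningful for g ≥ 2).
s : ℕ → ℕ → ℕ
s g n = digitSumAux g n n

Niven : ℕ → ℕ → Set
Niven g n = (1 ≤ n) × (s g n ∣ n)

{-# OPTIONS --safe #-}
module Submission where

-- Write G = g, h = g − 1 and R n = (Gⁿ − 1)/h.  For 1 ≤ z ≤ Gˡ the number z(Gˡ − 1) has digit
-- sum h·l whatever z is.  Two such factors, of lengths l and l₂ = h·l + 1, give numbers
--   x = z₁(Gˡ − 1) + G²ˡ z₂(G^l₂ − 1),   y = (Gˡ − z₁)(Gˡ − 1) + G²ˡ (G^l₂ − z₂)(G^l₂ − 1)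
-- with constant digit sums and constant x + y, and since R l and G²ˡ R l₂ are coprime, x/h can be
-- steered into any residue class modulo any K < Gˡ.  Take l = R (m − 1), so that the digit sum of
-- x and of y is Gᵐ − 1.
--
-- Given M, the summand n₃ has the low digits that make M − n₃ = Gᵐ(x + y + G^U (G^W + G^(W+1) T)),
-- completed by a block and some digits 1 so that its digit sum G^(m+2) − 1 divides it.  Then
--   n₂ = Gᵐ(y + G^U G^(W−C)),   n₁ = Gᵐ(x + G^U (G^W − G^(W−C) + G^(W+1) T)).
-- The digit sum of n₂ is Gᵐ, a divisor of n₂.  That of n₁ is Gᵐ − 1 + h·C + s(T), a multiple c Gᵐ
-- for suitable C < Gᵐ, and z₁, z₂ are chosen such that c divides n₁/Gᵐ.

open import Defs
open import Data.Nat using (ℕ; zero; suc; _+_; _*_; _∸_; _^_; _≤_; _<_; z≤n; s≤s; z<s; s≤s⁻¹; NonZero; >-nonZero)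
open import Data.Nat.Properties
open import Data.Nat.DivMod
open import Data.Nat.Divisibility
open import Data.Nat.Tactic.RingSolver using (solve-∀)
open import Data.Product using (_×_; _,_; proj₁; proj₂; ∃-syntax)
open import Relation.Binary.PropositionalEquality using (_≡_; refl; sym; trans; cong; cong₂; subst; module ≡-Reasoning)
open import Relation.Nullary using (yes; no; contradiction)

-- Used to pick the multipliers z₁ and z₂: they must be positive, hence `suc z`, and `z ≤ k` keeps
-- them at most the modulus `suc k`.
complement-mod : ∀ k v → ∃[ z ] (z ≤ k × suc k ∣ v + suc z)
complement-mod k v = k ∸ v % suc k , m∸n≤m k (v % suc k) , divides (suc (v / suc k)) eq
  where
  open ≡-Reasoning
  r = v % suc k
  rearrange : ∀ r q z → r + q + suc z ≡ suc (r + z) + q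
  rearrange = solve-∀
  eq : v + suc (k ∸ r) ≡ suc (v / suc k) * suc k
  eq = begin
    v + suc (k ∸ r)                       ≡⟨ cong (_+ suc (k ∸ r)) (m≡m%n+[m/n]*n v (suc k)) ⟩
    r + v / suc k * suc k + suc (k ∸ r)   ≡⟨ rearrange r (v / suc k * suc k) (k ∸ r) ⟩
    suc (r + (k ∸ r)) + v / suc k * suc k ≡⟨ cong (λ t → suc t + v / suc k * suc k) (m+[n∸m]≡n (s≤s⁻¹ (m%n<n v (suc k)))) ⟩
    suc (v / suc k) * suc k               ∎

module Base (h : ℕ) (1≤h : 1 ≤ h) where

  -- Digit sums in base `G`.

  G : ℕ
  G = suc h

  S : ℕ → ℕ
  S = s G

  fuel-irrelevant : ∀ k k′ n → n ≤ k → n ≤ k′ → digitSumAux G k n ≡ digitSumAux G k′ n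
  fuel-irrelevant zero    zero     n       _ _ = refl
  fuel-irrelevant zero    (suc k′) zero    _ _ = refl
  fuel-irrelevant (suc k) zero     zero    _ _ = refl
  fuel-irrelevant (suc k) (suc k′) zero    _ _ = refl
  fuel-irrelevant (suc k) (suc k′) (suc n) (s≤s n≤k) (s≤s n≤k′) =
    cong (suc n % G +_) (fuel-irrelevant k k′ (suc n / G) (≤-trans quot≤n n≤k) (≤-trans quot≤n n≤k′))
    where
    quot≤n : suc n / G ≤ n
    quot≤n = s≤s⁻¹ (m/n<m (suc n) G (s≤s 1≤h))

  S-divMod : ∀ n → S n ≡ n % G + S (n / G)
  S-divMod zero    = refl
  S-divMod (suc n) =
    cong (suc n % G +_) (fuel-irrelevant n (suc n / G) (suc n / G) (s≤s⁻¹ (m/n<m (suc n) G (s≤s 1≤h))) ≤-refl)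

  S-digit : ∀ {d} n → d < G → S (d + n * G) ≡ d + S n
  S-digit {d} n d<G = begin
    S (d + n * G)                           ≡⟨ S-divMod (d + n * G) ⟩
    (d + n * G) % G + S ((d + n * G) / G)   ≡⟨ cong₂ (λ a b → a + S b) rem quot ⟩
    d + S n                                 ∎
    where
    open ≡-Reasoning
    rem : (d + n * G) % G ≡ d
    rem = trans ([m+kn]%n≡m%n d n G) (m<n⇒m%n≡m d<G)
    quot : (d + n * G) / G ≡ n
    quot = trans (+-distrib-/-∣ʳ d (n∣m*n n)) (cong₂ _+_ (m<n⇒m/n≡0 d<G) (m*n/n≡m n G))

  quot< : ∀ n {A} → A < G ^ suc n → A / G < G ^ n
  quot< n {A} A< = m<n*o⇒m/o<n (subst (A <_) (*-comm G (G ^ n)) A<)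

  S-concat : ∀ n {A} B → A < G ^ n → S (A + G ^ n * B) ≡ S A + S B
  S-concat zero    {zero} B _ = cong S (*-identityˡ B)
  S-concat zero    {suc A} B (s≤s ())
  S-concat (suc n) {A} B A< = begin
    S (A + G ^ suc n * B)                     ≡⟨ cong (λ t → S (t + G ^ suc n * B)) (m≡m%n+[m/n]*n A G) ⟩
    S (A % G + A / G * G + G ^ suc n * B)     ≡⟨ cong S (rearrange (A % G) (A / G) G (G ^ n) B) ⟩
    S (A % G + (A / G + G ^ n * B) * G)       ≡⟨ S-digit (A / G + G ^ n * B) (m%n<n A G) ⟩
    A % G + S (A / G + G ^ n * B)             ≡⟨ cong (A % G +_) (S-concat n B (quot< n A<)) ⟩
    A % G + (S (A / G) + S B)                 ≡⟨ sym (+-assoc (A % G) _ _) ⟩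
    A % G + S (A / G) + S B                   ≡⟨ cong (_+ S B) (sym (S-divMod A)) ⟩
    S A + S B                                 ∎
    where
    open ≡-Reasoning
    rearrange : ∀ d a g p b → d + a * g + g * p * b ≡ d + (a + p * b) * g
    rearrange = solve-∀

  S-shift : ∀ n B → S (G ^ n * B) ≡ S B
  S-shift n B = S-concat n B (m^n>0 G n)

  concat-< : ∀ n k {A B} → A < G ^ n → B < G ^ k → A + G ^ n * B < G ^ (n + k)
  concat-< n k {A} {B} A< B< = begin-strict
    A + G ^ n * B       <⟨ +-monoˡ-< (G ^ n * B) A< ⟩
    G ^ n + G ^ n * B   ≡⟨ sym (*-suc (G ^ n) B) ⟩
    G ^ n * suc B       ≤⟨ *-monoʳ-≤ (G ^ n) B< ⟩
    G ^ n * G ^ k       ≡⟨ sym (^-distribˡ-+-* G n k) ⟩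
    G ^ (n + k)         ∎
    where open ≤-Reasoning

  -- Replacing every digit d by h - d causes no carries, and each of the n positions contributes h
  -- to the two digit sums together.
  S-complement : ∀ n A → A < G ^ n → ∃[ B ] (suc (A + B) ≡ G ^ n × S A + S B ≡ h * n)
  S-complement zero    zero    _ = 0 , refl , sym (*-zeroʳ h)
  S-complement zero    (suc A) (s≤s ())
  S-complement (suc n) A A< with S-complement n (A / G) (quot< n A<)
  ... | B , sum , digits = d′ + B * G , sum′ , digits′
    where
    open ≡-Reasoning
    d = A % G
    d′ = h ∸ d
    d+d′ : d + d′ ≡ h
    d+d′ = m+[n∸m]≡n (s≤s⁻¹ (m%n<n A G))
    rearrange : ∀ d a g e b → suc (d + a * g + (e + b * g)) ≡ suc (d + e) + g * (a + b)
    rearrange = solve-∀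
    rearrange′ : ∀ a b c d → a + b + (c + d) ≡ a + c + (b + d)
    rearrange′ = solve-∀
    sum′ : suc (A + (d′ + B * G)) ≡ G * G ^ n
    sum′ = begin
      suc (A + (d′ + B * G))             ≡⟨ cong (λ t → suc (t + (d′ + B * G))) (m≡m%n+[m/n]*n A G) ⟩
      suc (d + A / G * G + (d′ + B * G)) ≡⟨ rearrange d (A / G) G d′ B ⟩
      suc (d + d′) + G * (A / G + B)     ≡⟨ cong (λ t → suc t + G * (A / G + B)) d+d′ ⟩
      G + G * (A / G + B)                ≡⟨ sym (*-suc G (A / G + B)) ⟩
      G * suc (A / G + B)                ≡⟨ cong (G *_) sum ⟩
      G * G ^ n                          ∎
    digits′ : S A + S (d′ + B * G) ≡ h * suc n
    digits′ = begin
      S A + S (d′ + B * G)               ≡⟨ cong₂ _+_ (S-divMod A) (S-digit B (s≤s (m∸n≤m h d))) ⟩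
      d + S (A / G) + (d′ + S B)         ≡⟨ rearrange′ d (S (A / G)) d′ (S B) ⟩
      d + d′ + (S (A / G) + S B)         ≡⟨ cong₂ _+_ d+d′ digits ⟩
      h + h * n                          ≡⟨ sym (*-suc h n) ⟩
      h * suc n                          ∎

  S-bound : ∀ n A → A < G ^ n → S A ≤ h * n
  S-bound n A A< with S-complement n A A<
  ... | B , _ , digits = subst (S A ≤_) digits (m≤m+n (S A) (S B))

  n<G^n : ∀ n → n < G ^ n
  n<G^n zero    = z<s
  n<G^n (suc n) = begin-strict
    suc n         ≤⟨ n<G^n n ⟩
    G ^ n         <⟨ m<m*n (G ^ n) G {{m^n≢0 G n}} (s≤s 1≤h) ⟩
    G ^ n * G     ≡⟨ *-comm (G ^ n) G ⟩
    G * G ^ n     ∎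
    where open ≤-Reasoning

  -- Every power of G is 1 mod h. The quotient is kept because divisibility is tested on it: if K
  -- divides both `S n` and `q`, then K divides n, whatever K and h have in common.
  casting-out : ∀ n → ∃[ q ] n ≡ S n + h * q
  casting-out n = go n n (n<G^n n)
    where
    rearrange : ∀ d x q h → d + (x + h * q) * suc h ≡ d + x + h * (x + q * suc h)
    rearrange = solve-∀
    go : ∀ k n → n < G ^ k → ∃[ q ] n ≡ S n + h * q
    go zero    zero    _ = 0 , sym (*-zeroʳ h)
    go zero    (suc n) (s≤s ())
    go (suc k) n n< with go k (n / G) (quot< k n<)
    ... | q , eq = S (n / G) + q * G , (begin
      n                                                  ≡⟨ m≡m%n+[m/n]*n n G ⟩
      n % G + n / G * G                                  ≡⟨ cong (λ t → n % G + t * G) eq ⟩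
      n % G + (S (n / G) + h * q) * G                    ≡⟨ rearrange (n % G) (S (n / G)) q h ⟩
      n % G + S (n / G) + h * (S (n / G) + q * G)        ≡⟨ cong (_+ h * (S (n / G) + q * G)) (sym (S-divMod n)) ⟩
      S n + h * (S (n / G) + q * G)                      ∎)
      where open ≡-Reasoning

  -- Repunits and their divisibility.

  R : ℕ → ℕ
  R zero    = 0
  R (suc n) = 1 + R n * G

  G^≡ : ∀ n → G ^ n ≡ 1 + h * R n
  G^≡ zero    = cong suc (sym (*-zeroʳ h))
  G^≡ (suc n) = trans (cong (G *_) (G^≡ n)) (rearrange h (R n))
    where
    rearrange : ∀ h r → suc h * (1 + h * r) ≡ 1 + h * (1 + r * suc h)
    rearrange = solve-∀

  hR<G^ : ∀ n → h * R n < G ^ n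
  hR<G^ n = ≤-reflexive (sym (G^≡ n))

  R<G^ : ∀ n → R n < G ^ n
  R<G^ n = ≤-<-trans (m≤n*m (R n) h {{>-nonZero 1≤h}}) (hR<G^ n)

  S-R : ∀ n → S (R n) ≡ n
  S-R zero    = refl
  S-R (suc n) = trans (S-digit (R n) (s≤s 1≤h)) (cong suc (S-R n))

  S-hR : ∀ n → S (h * R n) ≡ h * n
  S-hR n with S-complement n 0 (m^n>0 G n)
  ... | B , sum , digits = subst (λ t → S t ≡ h * n) (suc-injective (trans sum (G^≡ n))) digits

  R-+ : ∀ m n → R (m + n) ≡ R m + G ^ m * R n
  R-+ zero    n = sym (*-identityˡ (R n))
  R-+ (suc m) n = trans (cong (λ t → 1 + t * G) (R-+ m n)) (rearrange (R m) (G ^ m) (R n) G)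
    where
    rearrange : ∀ a p b g → 1 + (a + p * b) * g ≡ 1 + a * g + g * p * b
    rearrange = solve-∀

  R∣R* : ∀ l q → R l ∣ R (q * l)
  R∣R* l zero    = divides 0 refl
  R∣R* l (suc q) = subst (R l ∣_) (sym (R-+ l (q * l))) (∣m∣n⇒∣m+n ∣-refl (∣n⇒∣m*n (G ^ l) (R∣R* l q)))

  -- Both factors are 1 modulo `R l`: G²ˡ - 1 = h · R (2l) and R (q·l + 1) - 1 = G · R (q·l) are
  -- multiples of `R l`.
  R-bezout : ∀ l q → ∃[ E ] G ^ (l + l) * R (suc (q * l)) ≡ 1 + R l * E
  R-bezout l q with subst (λ t → R l ∣ R (l + t)) (+-identityʳ l) (R∣R* l 2) | R∣R* l q
  ... | divides a eqa | divides b eqb =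
    h * a + b * G + h * a * R l * (b * G) ,
    trans (cong₂ (λ x y → x * (1 + y * G)) (trans (G^≡ (l + l)) (cong (λ t → 1 + h * t) eqa)) eqb)
      (rearrange h a b G (R l))
    where
    rearrange : ∀ h a b g r → (1 + h * (a * r)) * (1 + b * r * g) ≡ 1 + r * (h * a + b * g + h * a * r * (b * g))
    rearrange = solve-∀

  -- Blocks with constant digit sum and prescribed residue.

  -- z(Gˡ − 1) consists of the digits of z − 1 followed by those of the complement of z − 1.
  S-multiple : ∀ l z → z < G ^ l → S (suc z * (h * R l)) ≡ h * l × suc z * (h * R l) < G ^ (l + l)
  S-multiple l z z< with S-complement l z z<
  ... | B , sum , digits =
    trans (cong S split) (trans (S-concat l z B<) (trans (+-comm (S B) (S z)) digits)) ,
    subst (_< G ^ (l + l)) (sym split) (concat-< l l B< z<)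
    where
    B< : B < G ^ l
    B< = subst (B <_) sum (s≤s (m≤n+m B z))
    hR≡ : h * R l ≡ z + B
    hR≡ = suc-injective (trans (sym (G^≡ l)) (sym sum))
    rearrange : ∀ z b → suc z * (z + b) ≡ b + suc (z + b) * z
    rearrange = solve-∀
    split : suc z * (h * R l) ≡ B + G ^ l * z
    split = trans (cong (suc z *_) hR≡) (trans (rearrange z B) (cong (λ t → B + t * z) sum))

  -- x and y have constant digit sum and constant total, while x runs through all the
  -- residues mod K that are compatible with its digit sum.
  record Block (U w σ K v : ℕ) : Set where
    field
      x y q : ℕ
      x+y≡w : x + y ≡ w
      Sx    : S x ≡ σ
      Sy    : S y ≡ σ
      x<    : x < G ^ U
      y<    : y < G ^ U
      x≡    : x ≡ σ + h * q
      K∣    : K ∣ v + q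

  blockLength : ℕ → ℕ
  blockLength l = l + l + (suc (h * l) + suc (h * l))

  blockTotal : ℕ → ℕ
  blockTotal l = G ^ l * (h * R l) + G ^ (l + l) * (G ^ suc (h * l) * (h * R (suc (h * l))))

  blockTotal< : ∀ l → blockTotal l < G ^ blockLength l
  blockTotal< l = concat-< (l + l) _ (half l) (half (suc (h * l)))
    where
    half : ∀ l → G ^ l * (h * R l) < G ^ (l + l)
    half l = concat-< l l (m^n>0 G l) (hR<G^ l)

  -- Write x = h·Z and ρ = l + l₂. The digit sum gives Z = ρ + q, and `R-bezout` gives Z = z₂ + R l
  -- · (E·z₂ + z₁). Modulo K = k + 1, kρ stands for -ρ, so v + q ≡ v + kρ + Z. First z₂ = `suc b` is
  -- chosen to make v + kρ + z₂ vanish, then z₁ = `suc a` to make E·z₂ + z₁ vanish.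
  block : ∀ l K v → 1 ≤ K → K < G ^ l →
    Block (blockLength l) (blockTotal l) (h * (l + suc (h * l))) K v
  block l (suc k) v _ K<
    with R-bezout l h | complement-mod k (v + k * (l + suc (h * l)))
  ... | E , bez | b , b≤k , K∣b with complement-mod k (E * suc b)
  ... | a , a≤k , K∣a
    -- The multipliers Gˡ - z₁ and G^l₂ - z₂ of y must be positive too: z₁ ≤ K < Gˡ, and likewise
    -- for z₂ because l ≤ l₂.
    with m≤n⇒∃[o]m+o≡n (≤-trans (s≤s (s≤s a≤k)) K<)
       | m≤n⇒∃[o]m+o≡n (≤-trans (≤-trans (s≤s (s≤s b≤k)) K<) (^-monoʳ-≤ G (m≤n⇒m≤1+n (m≤n*m l h {{>-nonZero 1≤h}}))))
  ... | a′ , sum-a | b′ , sum-b = record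
    { x = x ; y = y ; q = q
    ; x+y≡w = x+y
    ; Sx = Sx
    ; Sy = S-pair a′< b′<
    ; x< = pair< a< b<
    ; y< = pair< a′< b′<
    ; x≡ = trans (proj₂ (casting-out x)) (cong (_+ h * q) Sx)
    ; K∣ = ∣m+n∣m⇒∣n (subst (suc k ∣_) regroup K∣Z) (m∣m*n ρ)
    }
    where
    l₂ = suc (h * l)
    ρ  = l + l₂
    pair : ℕ → ℕ → ℕ
    pair a b = suc a * (h * R l) + G ^ (l + l) * (suc b * (h * R l₂))
    x = pair a b
    y = pair a′ b′
    S-pair : ∀ {a b} → a < G ^ l → b < G ^ l₂ → S (pair a b) ≡ h * ρ
    S-pair {a} {b} a< b< =
      trans (S-concat (l + l) _ (proj₂ (S-multiple l a a<)))
        (trans (cong₂ _+_ (proj₁ (S-multiple l a a<)) (proj₁ (S-multiple l₂ b b<)))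
          (sym (*-distribˡ-+ h l l₂)))
    pair< : ∀ {a b} → a < G ^ l → b < G ^ l₂ → pair a b < G ^ blockLength l
    pair< {a} {b} a< b< =
      concat-< (l + l) (l₂ + l₂) (proj₂ (S-multiple l a a<)) (proj₂ (S-multiple l₂ b b<))
    a< : a < G ^ l
    a< = subst (a <_) sum-a (s≤s (m≤n⇒m≤1+n (m≤m+n a a′)))
    a′< : a′ < G ^ l
    a′< = subst (a′ <_) sum-a (s≤s (m≤n⇒m≤1+n (m≤n+m a′ a)))
    b< : b < G ^ l₂
    b< = subst (b <_) sum-b (s≤s (m≤n⇒m≤1+n (m≤m+n b b′)))
    b′< : b′ < G ^ l₂
    b′< = subst (b′ <_) sum-b (s≤s (m≤n⇒m≤1+n (m≤n+m b′ b)))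
    Sx : S x ≡ h * ρ
    Sx = S-pair a< b<
    q = proj₁ (casting-out x)
    x+y : x + y ≡ blockTotal l
    x+y = trans (rearrange a b a′ b′ (h * R l) (G ^ (l + l)) (h * R l₂))
            (cong₂ (λ s t → s * (h * R l) + G ^ (l + l) * (t * (h * R l₂))) sum-a sum-b)
      where
      rearrange : ∀ a b a′ b′ u p t →
        suc a * u + p * (suc b * t) + (suc a′ * u + p * (suc b′ * t)) ≡
        (suc (suc a) + a′) * u + p * ((suc (suc b) + b′) * t)
      rearrange = solve-∀
    Z = suc a * R l + suc b * (1 + R l * E)
    x≡hZ : x ≡ h * Z
    x≡hZ = trans (rearrange (suc a) (suc b) h (R l) (G ^ (l + l)) (R l₂))
             (cong (λ t → h * (suc a * R l + suc b * t)) bez)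
      where
      rearrange : ∀ a b h r p t → a * (h * r) + p * (b * (h * t)) ≡ h * (a * r + b * (p * t))
      rearrange = solve-∀
    Z≡ : Z ≡ ρ + q
    Z≡ = *-cancelˡ-≡ Z (ρ + q) h {{>-nonZero 1≤h}} (begin
      h * Z           ≡⟨ sym x≡hZ ⟩
      x               ≡⟨ proj₂ (casting-out x) ⟩
      S x + h * q     ≡⟨ cong (_+ h * q) Sx ⟩
      h * ρ + h * q   ≡⟨ sym (*-distribˡ-+ h ρ q) ⟩
      h * (ρ + q)     ∎)
      where open ≡-Reasoning
    K∣Z : suc k ∣ v + k * ρ + suc b + R l * (E * suc b + suc a)
    K∣Z = ∣m∣n⇒∣m+n K∣b (∣n⇒∣m*n (R l) K∣a)
    regroup : v + k * ρ + suc b + R l * (E * suc b + suc a) ≡ suc k * ρ + (v + q)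
    regroup = trans (rearrange₁ (v + k * ρ) (suc b) (R l) E (suc a))
                (trans (cong (v + k * ρ +_) Z≡) (rearrange₂ v k ρ q))
      where
      rearrange₁ : ∀ u b r e a → u + b + r * (e * b + a) ≡ u + (a * r + b * (1 + r * e))
      rearrange₁ = solve-∀
      rearrange₂ : ∀ v k ρ q → v + k * ρ + (ρ + q) ≡ suc k * ρ + (v + q)
      rearrange₂ = solve-∀

  -- The third summand.

  niven : ∀ {n K} → 1 ≤ K → S n ≡ K → K ∣ n → Niven G n
  niven {zero}  1≤K refl _   = contradiction 1≤K (λ ())
  niven {suc n} _   refl K∣n = z<s , K∣n

  n≤R : ∀ n → n ≤ R n
  n≤R zero    = z≤n
  n≤R (suc n) = s≤s (≤-trans (n≤R n) (m≤m*n (R n) G))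

  1≤hR : ∀ n → 1 ≤ h * R (suc n)
  1≤hR n = *-mono-≤ 1≤h (s≤s z≤n)

  -- Any prescribed low digits r extend to a Niven number with digit sum K = G^(j+1) − 1:
  -- the block settles divisibility (G being invertible mod K), and p digits 1 settle the digit sum.
  extend-to-niven : ∀ l j a {r} → r < G ^ a → a + (l + suc (h * l)) ≤ R (suc j) → h * R (suc j) < G ^ l →
    ∃[ H ] (H < G ^ (blockLength l + h * R (suc j)) × Niven G (r + G ^ a * H))
  extend-to-niven l j a {r} r< room K< =
    H , concat-< U K x< Rp< , niven (1≤hR j) S-n (subst (K ∣_) (sym n≡) (∣m∣n⇒∣m+n ∣-refl (∣n⇒∣m*n h K∣rest)))
    where
    open ≡-Reasoning
    U = blockLength l
    K = h * R (suc j)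
    σ = h * (l + suc (h * l))
    -- Here `room` enters: S r ≤ h·a, so S r + σ ≤ h·(a + l + l₂) ≤ K, and the subtraction defining
    -- `p` is not truncated.
    Sr+σ≤K : S r + σ ≤ K
    Sr+σ≤K = ≤-trans (+-monoˡ-≤ σ (S-bound a r r<))
               (≤-trans (≤-reflexive (sym (*-distribˡ-+ h a (l + suc (h * l))))) (*-monoʳ-≤ h room))
    p = K ∸ (S r + σ)
    A = r + G ^ a * (G ^ U * R p)
    qA = proj₁ (casting-out A)
    S-A : S A ≡ S r + p
    S-A = trans (S-concat a _ r<) (cong (S r +_) (trans (S-shift U (R p)) (S-R p)))
    -- All of (n - K)/h except the term in `q`; see `n≡`.
    v = qA + R a * σ
    -- As K = G^(j+1) - 1, G^(a·j) inverts G^a modulo K. The block yields K ∣ v · G⁻ᵃ + q, and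
    -- multiplying by G^a turns this into K ∣ v + G^a · q.
    G⁻ᵃ = G ^ (a * j)
    open Block (block l K (v * G⁻ᵃ) (1≤hR j) K<)
    H = x + G ^ U * R p
    Rp< : R p < G ^ K
    Rp< = <-≤-trans (R<G^ p) (^-monoʳ-≤ G (m∸n≤m K (S r + σ)))
    S-n : S (r + G ^ a * H) ≡ K
    S-n = begin
      S (r + G ^ a * H)       ≡⟨ S-concat a H r< ⟩
      S r + S H               ≡⟨ cong (S r +_) (S-concat U (R p) x<) ⟩
      S r + (S x + S (R p))   ≡⟨ cong₂ (λ s t → S r + (s + t)) Sx (S-R p) ⟩
      S r + (σ + p)           ≡⟨ sym (+-assoc (S r) σ p) ⟩
      S r + σ + p             ≡⟨ m+[n∸m]≡n Sr+σ≤K ⟩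
      K                       ∎
    rearrange₁ : ∀ r p x t → r + p * (x + t) ≡ r + p * t + p * x
    rearrange₁ = solve-∀
    rearrange₂ : ∀ sr p h qA ra σ q → sr + p + h * qA + (1 + h * ra) * (σ + h * q) ≡
      sr + σ + p + h * (qA + ra * σ + (1 + h * ra) * q)
    rearrange₂ = solve-∀
    n≡ : r + G ^ a * H ≡ K + h * (v + G ^ a * q)
    n≡ = begin
      r + G ^ a * H                                             ≡⟨ rearrange₁ r (G ^ a) x (G ^ U * R p) ⟩
      A + G ^ a * x                                             ≡⟨ cong₂ (λ s t → s + G ^ a * t) (proj₂ (casting-out A)) x≡ ⟩
      S A + h * qA + G ^ a * (σ + h * q)                        ≡⟨ cong₂ (λ s t → s + h * qA + t * (σ + h * q)) S-A (G^≡ a) ⟩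
      S r + p + h * qA + (1 + h * R a) * (σ + h * q)            ≡⟨ rearrange₂ (S r) p h qA (R a) σ q ⟩
      S r + σ + p + h * (v + (1 + h * R a) * q)                 ≡⟨ cong₂ (λ s t → s + h * (v + t * q)) (m+[n∸m]≡n Sr+σ≤K) (sym (G^≡ a)) ⟩
      K + h * (v + G ^ a * q)                                   ∎
    unit : K ∣ h * R (a * suc j)
    unit = *-monoʳ-∣ h (R∣R* (suc j) a)
    rearrange₃ : ∀ p v i q → p * (v * i + q) ≡ v * (p * i) + p * q
    rearrange₃ = solve-∀
    rearrange₄ : ∀ v t u → v * (1 + t) + u ≡ v * t + (v + u)
    rearrange₄ = solve-∀
    G^a*G⁻ᵃ : G ^ a * G⁻ᵃ ≡ 1 + h * R (a * suc j)
    G^a*G⁻ᵃ = trans (sym (^-distribˡ-+-* G a (a * j))) (trans (cong (G ^_) (sym (*-suc a j))) (G^≡ (a * suc j)))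
    K∣rest : K ∣ v + G ^ a * q
    K∣rest = ∣m+n∣m⇒∣n (subst (K ∣_) (begin
      G ^ a * (v * G⁻ᵃ + q)                              ≡⟨ rearrange₃ (G ^ a) v G⁻ᵃ q ⟩
      v * (G ^ a * G⁻ᵃ) + G ^ a * q                      ≡⟨ cong (λ t → v * t + G ^ a * q) G^a*G⁻ᵃ ⟩
      v * (1 + h * R (a * suc j)) + G ^ a * q            ≡⟨ rearrange₄ v (h * R (a * suc j)) (G ^ a * q) ⟩
      v * (h * R (a * suc j)) + (v + G ^ a * q)          ∎)
      (∣n⇒∣m*n (G ^ a) K∣)) (∣n⇒∣m*n v unit)

  -- The first two summands.

  -- This is why l is taken to be a repunit: for l = R n the block digit sum h·(l + l₂) is h · R (n
  -- + 1) = G^(n+1) - 1, one short of a power of G.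
  blockSum : ∀ n → R n + suc (h * R n) ≡ R (suc n)
  blockSum n = rearrange (R n) h
    where
    rearrange : ∀ r h → r + suc (h * r) ≡ 1 + r * suc h
    rearrange = solve-∀

  -- Splitting G^W = (G^W − G^(W−C)) + G^(W−C) raises the digit sum of the first summand
  -- by hC; as h is invertible mod G^m, C can be chosen to make that digit sum a multiple of G^m.
  two-niven : ∀ e T → G ^ (2 + e) + S T ≤ G ^ R e →
    let m = suc e ; U = blockLength (R e) ; W = G ^ m in
    ∃[ n₁ ] ∃[ n₂ ] (Niven G n₁ × Niven G n₂ ×
      n₁ + n₂ ≡ G ^ m * (blockTotal (R e) + G ^ U * (G ^ W + G ^ suc W * T)))
  two-niven e T bound = P * (x + Y) , P * (y + Y′) , niven 1≤cP S-n₁ cP∣n₁ , niven (m^n>0 G m) S-n₂ (m∣m*n (y + Y′)) , total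
    where
    m = suc e
    l = R e
    U = blockLength l
    P = G ^ m
    W = P
    ρ = l + suc (h * l)
    hρ≡ : h * ρ ≡ h * R m
    hρ≡ = cong (h *_) (blockSum e)
    1+hρ : 1 + h * ρ ≡ P
    1+hρ = trans (cong suc hρ≡) (sym (G^≡ m))
    instance
      P≢0 : NonZero P
      P≢0 = m^n≢0 G m
    -- Since h · R m = P - 1, `R m` is -1/h modulo P, so h·C ≡ -(S T + h·ρ).
    F = (S T + h * ρ) * R m
    C = F % P
    C<W : C < W
    C<W = m%n<n F P
    D = W ∸ C
    D+C : D + C ≡ W
    D+C = m∸n+n≡m (<⇒≤ C<W)
    -- G^W - G^(W-C) = G^D (G^C - 1): C digits h in the positions from D to W - 1.
    carry = G ^ D * (h * R C)
    carry< : carry < G ^ suc W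
    carry< = <-≤-trans (subst (λ t → carry < G ^ t) D+C (concat-< D C (m^n>0 G D) (hR<G^ C))) (^-monoʳ-≤ G (n≤1+n W))
    X = carry + G ^ suc W * T
    S-X : S X ≡ h * C + S T
    S-X = trans (S-concat (suc W) T carry<) (cong (_+ S T) (trans (S-shift D (h * R C)) (S-hR C)))
    Y = G ^ U * X
    qY = proj₁ (casting-out Y)
    S-Y : S Y ≡ h * C + S T
    S-Y = trans (S-shift U X) S-X
    Y′ = G ^ U * G ^ D
    S-G^D : S (G ^ D) ≡ 1
    S-G^D = trans (cong S (sym (*-identityʳ (G ^ D)))) (trans (S-shift D 1) (S-R 1))
    P∣ : P ∣ h * ρ + (h * C + S T)
    P∣ = ∣m+n∣m⇒∣n (divides (S T + h * ρ) (begin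
      h * (F / P) * P + (h * ρ + (h * C + S T))      ≡⟨ rearrange₁ h (F / P) P ρ C (S T) ⟩
      h * (C + F / P * P) + (S T + h * ρ)            ≡⟨ cong (λ t → h * t + (S T + h * ρ)) (sym (m≡m%n+[m/n]*n F P)) ⟩
      h * F + (S T + h * ρ)                          ≡⟨ rearrange₂ h (S T + h * ρ) (R m) ⟩
      (S T + h * ρ) * (1 + h * R m)                  ≡⟨ cong ((S T + h * ρ) *_) (sym (G^≡ m)) ⟩
      (S T + h * ρ) * P                              ∎)) (n∣m*n (h * (F / P)))
      where
      open ≡-Reasoning
      rearrange₁ : ∀ h f p ρ c s → h * f * p + (h * ρ + (h * c + s)) ≡ h * (c + f * p) + (s + h * ρ)
      rearrange₁ = solve-∀
      rearrange₂ : ∀ h a r → h * (a * r) + a ≡ a * (1 + h * r)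
      rearrange₂ = solve-∀
    c = quotient P∣
    cP : h * ρ + (h * C + S T) ≡ c * P
    cP = _∣_.equality P∣
    1≤cP : 1 ≤ c * P
    1≤cP = ≤-trans (1≤hR e) (≤-trans (≤-reflexive (sym hρ≡)) (≤-trans (m≤m+n (h * ρ) (h * C + S T)) (≤-reflexive cP)))
    1≤c : 1 ≤ c
    1≤c = positive c 1≤cP
      where
      positive : ∀ c → 1 ≤ c * P → 1 ≤ c
      positive (suc c) _ = z<s
    -- As c ≤ c·P, bounding the digit sum is enough: h·ρ + h·C < P + h·P = G^(m+1).
    c< : c < G ^ l
    c< = begin-strict
      c                              ≤⟨ m≤m*n c P ⟩
      c * P                          ≡⟨ sym cP ⟩
      h * ρ + (h * C + S T)          <⟨ +-monoˡ-< (h * C + S T) (≤-reflexive 1+hρ) ⟩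
      P + (h * C + S T)              ≤⟨ +-monoʳ-≤ P (+-monoˡ-≤ (S T) (*-monoʳ-≤ h (<⇒≤ C<W))) ⟩
      P + (h * P + S T)              ≡⟨ sym (+-assoc P (h * P) (S T)) ⟩
      G ^ (2 + e) + S T              ≤⟨ bound ⟩
      G ^ l                          ∎
      where open ≤-Reasoning
    -- The casting-out quotients add up: x + Y = c·P + h·(qY + q), so the block is asked for c ∣ qY
    -- + q.
    open Block (block l c qY 1≤c c<)
    S-x+Y : S (x + Y) ≡ c * P
    S-x+Y = trans (S-concat U X x<) (trans (cong₂ _+_ Sx S-X) cP)
    S-n₁ : S (P * (x + Y)) ≡ c * P
    S-n₁ = trans (S-shift m (x + Y)) S-x+Y
    c∣x+Y : c ∣ x + Y
    c∣x+Y = subst (c ∣_) (sym (begin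
      x + Y                                            ≡⟨ cong₂ _+_ x≡ (proj₂ (casting-out Y)) ⟩
      h * ρ + h * q + (S Y + h * qY)                   ≡⟨ cong (λ t → h * ρ + h * q + (t + h * qY)) S-Y ⟩
      h * ρ + h * q + (h * C + S T + h * qY)           ≡⟨ rearrange h (h * ρ) q (h * C + S T) qY ⟩
      h * ρ + (h * C + S T) + h * (qY + q)             ≡⟨ cong (_+ h * (qY + q)) cP ⟩
      c * P + h * (qY + q)                             ∎)) (∣m∣n⇒∣m+n (m∣m*n P) (∣n⇒∣m*n h K∣))
      where
      open ≡-Reasoning
      rearrange : ∀ h a q b q′ → a + h * q + (b + h * q′) ≡ a + b + h * (q′ + q)
      rearrange = solve-∀
    cP∣n₁ : c * P ∣ P * (x + Y)
    cP∣n₁ = subst (_∣ P * (x + Y)) (*-comm P c) (*-monoʳ-∣ P c∣x+Y)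
    S-n₂ : S (P * (y + Y′)) ≡ P
    S-n₂ = trans (S-shift m (y + Y′)) (trans (S-concat U (G ^ D) y<) (trans (cong₂ _+_ Sy S-G^D) (trans (+-comm (h * ρ) 1) 1+hρ)))
    total : P * (x + Y) + P * (y + Y′) ≡ P * (blockTotal l + G ^ U * (G ^ W + G ^ suc W * T))
    total = begin
      P * (x + Y) + P * (y + Y′)
        ≡⟨ rearrange P x (G ^ U) (G ^ D) (h * R C) (G ^ suc W * T) y ⟩
      P * (x + y + G ^ U * (G ^ D * (1 + h * R C) + G ^ suc W * T))
        ≡⟨ cong₂ (λ s t → P * (s + G ^ U * (t + G ^ suc W * T))) x+y≡w G^D*G^C ⟩
      P * (blockTotal l + G ^ U * (G ^ W + G ^ suc W * T)) ∎
      where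
      open ≡-Reasoning
      rearrange : ∀ p x u d c t y →
        p * (x + u * (d * c + t)) + p * (y + u * d) ≡ p * (x + y + u * (d * (1 + c) + t))
      rearrange = solve-∀
      G^D*G^C : G ^ D * (1 + h * R C) ≡ G ^ W
      G^D*G^C = trans (cong (G ^ D *_) (sym (G^≡ C))) (trans (sym (^-distribˡ-+-* G D C)) (cong (G ^_) D+C))

  -- Size estimates, and the representation of one range of M.

  module Window (2≤h : 2 ≤ h) where

    -- The base case is R 3 = 1 + G + G² ≥ 13, by G ≥ 3. The resulting G^(7+e) ≤ G^(R e) puts both
    -- moduli at scale e below the limit `K < G ^ l` of `block`.
    7+e≤R : ∀ f → 7 + (3 + f) ≤ R (3 + f)
    7+e≤R zero with m≤n⇒∃[o]m+o≡n 2≤h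
    ... | i , refl = ≤-trans (m≤m+n 10 (3 + 7 * i + i * i)) (≤-reflexive (rearrange i))
      where
      rearrange : ∀ i → 10 + (3 + 7 * i + i * i) ≡ 1 + (1 + (1 + 0 * (3 + i)) * (3 + i)) * (3 + i)
      rearrange = solve-∀
    7+e≤R (suc f) = s≤s (≤-trans (7+e≤R f) (m≤m*n (R (3 + f)) G))

    blockLength≡ : ∀ n → blockLength (R n) ≡ R (suc n) + R (suc n)
    blockLength≡ n = trans (rearrange (R n) (suc (h * R n))) (cong₂ _+_ (blockSum n) (blockSum n))
      where
      rearrange : ∀ a b → a + a + (b + b) ≡ a + b + (a + b)
      rearrange = solve-∀

    -- The position where T begins in Gᵐ(x + y + G^U (G^W + G^(W+1) T)); the digits below it do not
    -- depend on T.
    lowLength : ℕ → ℕ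
    lowLength e = suc e + (blockLength (R e) + suc (G ^ suc e))

    -- Low digits and block must not exhaust the digit sum h · R (m + 2) of n₃. With ρ = R m the
    -- left side is at most (G + 3)ρ + 2, and the right side is G²ρ + G + 1, which dominates once G
    -- ≥ 3; R (m + 1) = Gρ + 1 would be too small.
    lowLength-bound : ∀ e → lowLength e + R (suc e) ≤ R (3 + e)
    lowLength-bound e = begin
      lowLength e + ρ
        ≡⟨ cong₂ (λ s t → suc e + (s + suc t) + ρ) (blockLength≡ e) (G^≡ (suc e)) ⟩
      suc e + (ρ + ρ + suc (1 + h * ρ)) + ρ
        ≤⟨ +-monoˡ-≤ ρ (+-monoˡ-≤ (ρ + ρ + suc (1 + h * ρ)) (n≤R (suc e))) ⟩
      ρ + (ρ + ρ + suc (1 + h * ρ)) + ρ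
        ≤⟨ quadratic 2≤h ρ ⟩
      R (3 + e) ∎
      where
      open ≤-Reasoning
      ρ = R (suc e)
      quadratic : ∀ {h} → 2 ≤ h → ∀ ρ → ρ + (ρ + ρ + suc (1 + h * ρ)) + ρ ≤ 1 + (1 + ρ * suc h) * suc h
      quadratic 2≤h ρ with m≤n⇒∃[o]m+o≡n 2≤h
      -- The added polynomial is the difference of the two sides at h = 2 + i.
      ... | i , refl = ≤-trans (m≤m+n _ (2 + i + (3 + 5 * i + i * i) * ρ)) (≤-reflexive (rearrange i ρ))
        where
        rearrange : ∀ i ρ → ρ + (ρ + ρ + suc (1 + (2 + i) * ρ)) + ρ + (2 + i + (3 + 5 * i + i * i) * ρ) ≡
          1 + (1 + ρ * (3 + i)) * (3 + i)
        rearrange = solve-∀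

    -- Bounds the length of n₃: low digits, block, and at most K = h · R (3 + e) digits 1. Hence the
    -- lower end G^R(5+e) of the range of M.
    totalLength-bound : ∀ e → lowLength e + (blockLength (R e) + h * R (3 + e)) ≤ R (5 + e)
    totalLength-bound e = begin
      lowLength e + (blockLength (R e) + h * κ)  ≡⟨ cong (λ t → lowLength e + (t + h * κ)) (blockLength≡ e) ⟩
      lowLength e + (ρ + ρ + h * κ)              ≡⟨ regroup (lowLength e) ρ (h * κ) ⟩
      lowLength e + ρ + ρ + h * κ                ≤⟨ +-monoˡ-≤ (h * κ) (+-mono-≤ (lowLength-bound e) ρ≤κ) ⟩
      κ + κ + h * κ                              ≤⟨ quadratic 1≤h κ ⟩
      R (5 + e)                                  ∎
      where
      open ≤-Reasoning
      ρ = R (suc e)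
      κ = R (3 + e)
      ρ≤κ : ρ ≤ κ
      ρ≤κ = ≤-trans (m≤n+m ρ (lowLength e)) (lowLength-bound e)
      regroup : ∀ a ρ k → a + (ρ + ρ + k) ≡ a + ρ + ρ + k
      regroup = solve-∀
      quadratic : ∀ {h} → 1 ≤ h → ∀ κ → κ + κ + h * κ ≤ 1 + (1 + κ * suc h) * suc h
      quadratic 1≤h κ with m≤n⇒∃[o]m+o≡n 1≤h
      ... | i , refl = ≤-trans (m≤m+n _ (3 + i + (1 + 3 * i + i * i) * κ)) (≤-reflexive (rearrange i κ))
        where
        rearrange : ∀ i κ → κ + κ + (1 + i) * κ + (3 + i + (1 + 3 * i + i * i) * κ) ≡
          1 + (1 + κ * (2 + i)) * (2 + i)
        rearrange = solve-∀

    -- The lower bound on M makes room for n₃; the upper one bounds the digit sum of T and thereby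
    -- c. The ranges of consecutive e abut.
    three-niven : ∀ e M → 7 + e ≤ R e → G ^ R (5 + e) ≤ M → M < G ^ R (6 + e) →
      ∃[ n₁ ] ∃[ n₂ ] ∃[ n₃ ] (Niven G n₁ × Niven G n₂ × Niven G n₃ × M ≡ n₁ + n₂ + n₃)
    three-niven e M e-large lower upper = conclude (extend-to-niven (R e) (2 + e) a r< room K<)
      where
      m = suc e
      U = blockLength (R e)
      W = G ^ m
      a = lowLength e
      -- Gᵐ·w is the value of M - n₃ at T = 0, hence its residue modulo G^a for every T.
      w = blockTotal (R e) + G ^ U * G ^ W
      instance
        G^a≢0 : NonZero (G ^ a)
        G^a≢0 = m^n≢0 G a
      K = h * R (3 + e)
      low≤ : G ^ m * w ≤ G ^ a
      low≤ = <⇒≤ (concat-< m (U + suc W) (m^n>0 G m) (concat-< U (suc W) (blockTotal< (R e)) (^-monoʳ-< G (s≤s 1≤h) (n<1+n W))))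
      -- `D` stands for -Gᵐ·w modulo G^a, so that r ≡ M - Gᵐ·w. The extra G^a is paid back by the
      -- `suc` in `Q ∸ suc H`.
      D = G ^ a ∸ G ^ m * w
      r = (M + D) % G ^ a
      Q = (M + D) / G ^ a
      r< : r < G ^ a
      r< = m%n<n (M + D) (G ^ a)
      room : a + (R e + suc (h * R e)) ≤ R (3 + e)
      room = subst (λ t → a + t ≤ R (3 + e)) (sym (blockSum e)) (lowLength-bound e)
      K< : K < G ^ R e
      K< = <-≤-trans (hR<G^ (3 + e)) (^-monoʳ-≤ G (≤-trans (+-monoˡ-≤ e (m≤m+n 3 4)) e-large))
      conclude : ∃[ H ] (H < G ^ (U + K) × Niven G (r + G ^ a * H)) →
        ∃[ n₁ ] ∃[ n₂ ] ∃[ n₃ ] (Niven G n₁ × Niven G n₂ × Niven G n₃ × M ≡ n₁ + n₂ + n₃)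
      conclude (H , H< , niven₃) = finish (two-niven e T bound)
        where
        H<Q : suc H ≤ Q
        H<Q = s≤s⁻¹ (*-cancelˡ-< (G ^ a) (suc H) (suc Q) (begin-strict
          G ^ a * suc H            ≤⟨ *-monoʳ-≤ (G ^ a) H< ⟩
          G ^ a * G ^ (U + K)      ≡⟨ sym (^-distribˡ-+-* G a (U + K)) ⟩
          G ^ (a + (U + K))        ≤⟨ ^-monoʳ-≤ G (totalLength-bound e) ⟩
          G ^ R (5 + e)            ≤⟨ lower ⟩
          M                        ≤⟨ m≤m+n M D ⟩
          M + D                    ≡⟨ m≡m%n+[m/n]*n (M + D) (G ^ a) ⟩
          r + Q * G ^ a            <⟨ +-monoˡ-< (Q * G ^ a) r< ⟩
          suc Q * G ^ a            ≡⟨ *-comm (suc Q) (G ^ a) ⟩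
          G ^ a * suc Q            ∎))
          where open ≤-Reasoning
        T = Q ∸ suc H
        n₃ = r + G ^ a * H
        tail = G ^ m * (blockTotal (R e) + G ^ U * (G ^ W + G ^ suc W * T))
        G^a≡ : G ^ a ≡ G ^ m * (G ^ U * G ^ suc W)
        G^a≡ = trans (^-distribˡ-+-* G m (U + suc W)) (cong (G ^ m *_) (^-distribˡ-+-* G U (suc W)))
        M≡ : M ≡ tail + n₃
        M≡ = +-cancelʳ-≡ (G ^ a) M (tail + n₃) (begin
          M + G ^ a                                     ≡⟨ cong (M +_) (sym (m∸n+n≡m low≤)) ⟩
          M + (D + G ^ m * w)                           ≡⟨ sym (+-assoc M D (G ^ m * w)) ⟩
          M + D + G ^ m * w                             ≡⟨ cong (_+ G ^ m * w) (m≡m%n+[m/n]*n (M + D) (G ^ a)) ⟩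
          r + Q * G ^ a + G ^ m * w                     ≡⟨ cong (λ t → r + t * G ^ a + G ^ m * w) (sym (m+[n∸m]≡n H<Q)) ⟩
          r + (suc H + T) * G ^ a + G ^ m * w           ≡⟨ rearrange₁ r H T (G ^ a) (G ^ m * w) ⟩
          G ^ m * w + G ^ a * T + n₃ + G ^ a            ≡⟨ cong (λ t → G ^ m * w + t * T + n₃ + G ^ a) G^a≡ ⟩
          G ^ m * w + G ^ m * (G ^ U * G ^ suc W) * T + n₃ + G ^ a
            ≡⟨ cong (λ t → t + n₃ + G ^ a) (rearrange₂ (G ^ m) (blockTotal (R e)) (G ^ U) (G ^ W) (G ^ suc W) T) ⟩
          tail + n₃ + G ^ a                             ∎)
          where
          open ≡-Reasoning
          rearrange₁ : ∀ r H T p u → r + (suc H + T) * p + u ≡ u + p * T + (r + p * H) + p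
          rearrange₁ = solve-∀
          rearrange₂ : ∀ m b u w w′ t → m * (b + u * w) + m * (u * w′) * t ≡ m * (b + u * (w + w′ * t))
          rearrange₂ = solve-∀
        open ≤-Reasoning
        -- Crude but sufficient: T has at most R (6 + e) digits, so S T ≤ h · R (6 + e) < G^(6+e).
        T≤M : T ≤ M
        T≤M = begin
          T                                            ≤⟨ m≤n*m T (G ^ suc W) {{m^n≢0 G (suc W)}} ⟩
          G ^ suc W * T                                ≤⟨ m≤n+m (G ^ suc W * T) (G ^ W) ⟩
          G ^ W + G ^ suc W * T                        ≤⟨ m≤n*m _ (G ^ U) {{m^n≢0 G U}} ⟩
          G ^ U * (G ^ W + G ^ suc W * T)              ≤⟨ m≤n+m _ (blockTotal (R e)) ⟩
          blockTotal (R e) + G ^ U * (G ^ W + G ^ suc W * T) ≤⟨ m≤n*m _ (G ^ m) {{m^n≢0 G m}} ⟩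
          tail                                         ≤⟨ m≤m+n tail n₃ ⟩
          tail + n₃                                    ≡⟨ sym M≡ ⟩
          M                                            ∎
        bound : G ^ (2 + e) + S T ≤ G ^ R e
        bound = begin
          G ^ (2 + e) + S T             ≤⟨ +-mono-≤ (^-monoʳ-≤ G (+-monoˡ-≤ e (m≤m+n 2 4))) (S-bound (R (6 + e)) T (≤-<-trans T≤M upper)) ⟩
          G ^ (6 + e) + h * R (6 + e)   ≤⟨ +-monoʳ-≤ (G ^ (6 + e)) (<⇒≤ (hR<G^ (6 + e))) ⟩
          G ^ (6 + e) + G ^ (6 + e)     ≤⟨ +-monoʳ-≤ (G ^ (6 + e)) (m≤n*m (G ^ (6 + e)) h {{>-nonZero 1≤h}}) ⟩
          G ^ (7 + e)                   ≤⟨ ^-monoʳ-≤ G e-large ⟩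
          G ^ R e                       ∎
        finish : ∃[ n₁ ] ∃[ n₂ ] (Niven G n₁ × Niven G n₂ × n₁ + n₂ ≡ tail) →
          ∃[ n₁ ] ∃[ n₂ ] ∃[ n₃ ] (Niven G n₁ × Niven G n₂ × Niven G n₃ × M ≡ n₁ + n₂ + n₃)
        finish (n₁ , n₂ , niven₁ , niven₂ , sum) =
          n₁ , n₂ , n₃ , niven₁ , niven₂ , niven₃ , trans M≡ (cong (_+ n₃) (sym sum))

-- Covering all large M.

-- Linear search upward from `a`; `k` counts the steps left, and M < F (k + a) forces a crossing
-- before they run out.
bracket : ∀ (F : ℕ → ℕ) M k a → F a ≤ M → M < F (k + a) → ∃[ b ] (F b ≤ M × M < F (suc b))
bracket F M zero    a lo hi = contradiction lo (<⇒≱ hi)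
bracket F M (suc k) a lo hi with M <? F (suc a)
... | yes M< = a , lo , M<
... | no  M≮ = bracket F M k (suc a) (≮⇒≥ M≮) (subst (λ t → M < F t) (sym (+-suc k a)) hi)

theorem1p1 : (g : ℕ) → 3 ≤ g →
    ∃[ N₀ ] ((M : ℕ) → N₀ ≤ M →
    ∃[ n₁ ] ∃[ n₂ ] ∃[ n₃ ]
    (Niven g n₁ × Niven g n₂ × Niven g n₃ × (M ≡ n₁ + n₂ + n₃)))
theorem1p1 (suc h) (s≤s 2≤h) = F 0 , represent
  where
  1≤h = ≤-trans (n≤1+n 1) 2≤h
  open Base h 1≤h
  open Window 2≤h
  F : ℕ → ℕ
  -- Index f is the scale e = 3 + f, the least one that `7+e≤R` covers being e = 3, and 5 + e = 8 +
  -- f.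
  F f = G ^ R (8 + f)
  M<F : ∀ M → M < F (M + 0)
  M<F M = <-≤-trans (n<G^n M) (^-monoʳ-≤ G (≤-trans (≤-trans (m≤m+n M 0) (m≤n+m (M + 0) 8)) (n≤R (8 + (M + 0)))))
  represent : (M : ℕ) → F 0 ≤ M →
    ∃[ n₁ ] ∃[ n₂ ] ∃[ n₃ ] (Niven G n₁ × Niven G n₂ × Niven G n₃ × (M ≡ n₁ + n₂ + n₃))
  represent M F0≤M with bracket F M M 0 F0≤M (M<F M)
  ... | f , lo , hi = three-niven (3 + f) M (7+e≤R f) lo hi
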